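{- There is no minimally nonideal clutter matrix whose core is the point-line incidence matrix of the projective plane $\mathrm{PG}(2,3)$.
   Context: A clutter $\mathcal{C}=(V,E)$ is a finite set $V$ with a family $E$ of subsets of $V$ (hyperedges) none containing another; its clutter matrix has a row for each hyperedge (its incidence vector) and a column for each vertex. $\mathcal{C}$ (or its matrix $A$, of size $m\times n$) is ideal if the polyhedron $\{x\in\mathbb{R}^n: Ax\ge\mathbf{1},\ x\ge\mathbf{0}\}$ has only integral vertices. Deletion $\mathcal{C}\backslash v$: vertex set $V\setminus\{v\}$, hyperedges those of $\mathcal{C}$ not containing $v$. Contraction $\mathcal{C}/v$: vertex set $V\setminus\{v\}$, hyperedges the inclusion-minimal sets $H\setminus\{v\}$, $H\in E$. Minors are obtained by sequences of deletions and contractions. $\mathcal{C}$ is minimally nonideal if it is not ideal but every proper minor is ideal. The core of $A$ is the submatrix formed by its rows of minimum weight (number of ones); "the core is the point-line incidence matrix of a projective plane" means the vertices are the points and the minimum-cardinality hyperedges are exactly the lines. -}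

module Defs where

open import Data.Nat using (ℕ; zero; suc; _+_; _*_; _≤_)
open import Data.Nat.DivMod using (_%_)
open import Data.Integer using (ℤ)
open import Data.Rational as ℚ using (ℚ; 0ℚ; 1ℚ; ½; _/_)
open import Data.Fin using (Fin; zero; suc; toℕ)
open import Data.Fin.Subset using (Subset; _⊆_; ∣_∣; inside; outside)
open import Data.Vec using (lookup; removeAt)
open import Data.List using (List)
open import Data.List.Membership.Propositional as L using ()
open import Data.Product using (Σ; _×_; _,_; ∃; ∃-syntax)
open import Data.Sum using (_⊎_)
open import Function.Bundles using (_↔_; Inverse)
open import Relation.Binary.PropositionalEquality using (_≡_)
open import Relation.Nullary using (¬_)

-- Clutters on the vertex set Fin n.  A clutter is given by the list of
-- its hyperedges (rows of the clutter matrix), each a subset of Fin n.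
-- Repetitions in the list are harmless (the family is the set of
-- elements of the list; the polyhedron does not see repeated rows).

Family : ℕ → Set
Family n = List (Subset n)

IsClutter : ∀ {n} → Family n → Set
IsClutter E = ∀ {H H′} → H L.∈ E → H′ L.∈ E → H ⊆ H′ → H ≡ H′

IsDeletion : ∀ {n} → Family (suc n) → Fin (suc n) → Family n → Set
IsDeletion E i F =
  ∀ G → ((G L.∈ F → Σ _ λ H → H L.∈ E × lookup H i ≡ outside × removeAt H i ≡ G)
       × ((Σ _ λ H → H L.∈ E × lookup H i ≡ outside × removeAt H i ≡ G) → G L.∈ F))

Shadow : ∀ {n} → Family (suc n) → Fin (suc n) → Subset n → Set
Shadow E i G = Σ _ λ H → H L.∈ E × removeAt H i ≡ G

IsContraction : ∀ {n} → Family (suc n) → Fin (suc n) → Family n → Set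
IsContraction E i F =
  ∀ G → ((G L.∈ F → Shadow E i G × (∀ G′ → Shadow E i G′ → G′ ⊆ G → G′ ≡ G))
       × (Shadow E i G × (∀ G′ → Shadow E i G′ → G′ ⊆ G → G′ ≡ G) → G L.∈ F))

data Minor : ∀ {n k} → Family n → Family k → Set where
  here : ∀ {n} {E : Family n} → Minor E E
  del  : ∀ {n k} {E : Family (suc n)} (i : Fin (suc n)) {F : Family n}
           {G : Family k} → IsDeletion E i F → Minor F G → Minor E G
  con  : ∀ {n k} {E : Family (suc n)} (i : Fin (suc n)) {F : Family n}
           {G : Family k} → IsContraction E i F → Minor F G → Minor E G

data ProperMinor : ∀ {n k} → Family n → Family k → Set where
  del  : ∀ {n k} {E : Family (suc n)} (i : Fin (suc n)) {F : Family n}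
           {G : Family k} → IsDeletion E i F → Minor F G → ProperMinor E G
  con  : ∀ {n k} {E : Family (suc n)} (i : Fin (suc n)) {F : Family n}
           {G : Family k} → IsContraction E i F → Minor F G → ProperMinor E G

-- Idealness.  The polyhedron {x : Ax ≥ 1, x ≥ 0} has rational data, so
-- all its vertices are rational; we work in ℚ^n.  A vertex is an
-- extreme point: not the midpoint of two distinct points of P.

sumFin : ∀ {n} → (Fin n → ℚ) → ℚ
sumFin {zero}  f = 0ℚ
sumFin {suc n} f = f zero ℚ.+ sumFin (λ j → f (suc j))

rowSum : ∀ {n} → Subset n → (Fin n → ℚ) → ℚ
rowSum H x = sumFin (λ v → sel (lookup H v) (x v))
  where
  sel : _ → ℚ → ℚ
  sel inside  q = q
  sel outside q = 0ℚ

InP : ∀ {n} → Family n → (Fin n → ℚ) → Set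
InP E x = (∀ v → 0ℚ ℚ.≤ x v) × (∀ {H} → H L.∈ E → 1ℚ ℚ.≤ rowSum H x)

IsVertex : ∀ {n} → Family n → (Fin n → ℚ) → Set
IsVertex E x = InP E x × (∀ y z → InP E y → InP E z →
  (∀ v → x v ≡ ½ ℚ.* (y v ℚ.+ z v)) → ∀ v → y v ≡ z v)

Integral : ∀ {n} → (Fin n → ℚ) → Set
Integral x = ∀ v → ∃[ k ] x v ≡ k ℚ./ 1

Ideal : ∀ {n} → Family n → Set
Ideal E = ∀ x → IsVertex E x → Integral x

MinimallyNonideal : ∀ {n} → Family n → Set
MinimallyNonideal {n} E =
  ¬ Ideal E × (∀ {k} (F : Family k) → ProperMinor E F → Ideal F)

-- The projective plane PG(2,3): points (and, dually, lines) are the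
-- nonzero vectors of F₃³ normalised so that the first nonzero
-- coordinate is 1; point p lies on line ℓ iff p · ℓ = 0 in F₃.

F₃ : Set
F₃ = Fin 3

Normalised : F₃ × F₃ × F₃ → Set
Normalised (a , b , c) =
  a ≡ suc zero ⊎ (a ≡ zero × b ≡ suc zero) ⊎ (a ≡ zero × b ≡ zero × c ≡ suc zero)

PGPoint : Set
PGPoint = Σ (F₃ × F₃ × F₃) Normalised

PGLine : Set
PGLine = Σ (F₃ × F₃ × F₃) Normalised

OnLine : PGPoint → PGLine → Set
OnLine ((a , b , c) , _) ((a′ , b′ , c′) , _) =
  (toℕ a * toℕ a′ + toℕ b * toℕ b′ + toℕ c * toℕ c′) % 3 ≡ 0

-- Core.  Given an identification f of the vertices with the points of
-- PG(2,3), the core is the point-line incidence matrix when the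
-- minimum-cardinality hyperedges are exactly the lines.

MinWeight : ∀ {n} → Family n → Subset n → Set
MinWeight E H = H L.∈ E × (∀ {H′} → H′ L.∈ E → ∣ H ∣ ≤ ∣ H′ ∣)

IsLineSet : ∀ {n} → (Fin n ↔ PGPoint) → PGLine → Subset n → Set
IsLineSet f ℓ H =
  ∀ v → (lookup H v ≡ inside → OnLine (Inverse.to f v) ℓ)
      × (OnLine (Inverse.to f v) ℓ → lookup H v ≡ inside)

CoreIsPG23 : ∀ {n} → Family n → (Fin n ↔ PGPoint) → Set
CoreIsPG23 E f =
  (∀ H → MinWeight E H → ∃[ ℓ ] IsLineSet f ℓ H)
  × (∀ ℓ → ∃[ H ] (MinWeight E H × IsLineSet f ℓ H))

{-# OPTIONS --safe #-}
-- Suppose all proper minors are ideal. Ideality of a minor is used in one form only: if x is a fractional point of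
-- its polyhedron and c a cost, some transversal of the minor costs at most c · x.
--
-- Every line meets every edge. Otherwise let an edge miss the line L and let v be a point off L. In the
-- contraction by v the point with value 1/3 off v is feasible, and with cost 2 on L and 3 off L it costs 32/3.
-- Every transversal avoiding v costs at least 11, except L itself, which is not a transversal.
--
-- Hence a set containing a line contains an edge, and the complement of such a set does not. The remaining sets are
-- the vertex sets Q of the 234 complete quadrilaterals (six points each) and their complements. Disjointness of
-- the sets Q is a cubic graph. In its bipartite double cover, with vertices (edge, Q) and (cover, Q), call
-- (edge, Q) selected if Q contains an edge, (cover, Q) selected if Q is a transversal, and other vertices free. Since
-- there is no minor J₂, J₃ or J₄ (J_q is the degenerate projective plane on q + 1 points), no vertex has two selected
-- neighbours and no path on four vertices is free. This is impossible in a cubic graph: starting from any vertex,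
-- free neighbours can be chosen step by step to form a free path.
module Submission where

open import Defs
open import Data.Bool as Bool using (Bool; true; false; T; T?; _∧_; if_then_else_; not)
open import Data.Bool.Properties using (T-∧; T-≡)
open import Data.Empty using (⊥; ⊥-elim)
open import Data.Nat as ℕ using (ℕ; zero; suc)
import Data.Nat.Properties as ℕ
open import Data.Integer as ℤ using (-[1+_]; +≤+)
open import Data.Rational hiding (∣_∣)
open import Data.Rational.Properties
import Data.Rational.Unnormalised as ℚᵘ
import Data.Rational.Unnormalised.Properties as ℚᵘ
open import Data.Rational.Solver using (module +-*-Solver)
open +-*-Solver using (solve; _:=_; _:+_; _:*_; :-_; con)
open import Data.Fin using (Fin; zero; suc; punchIn)
open import Data.Fin.Patterns
import Data.Fin as Fin
import Data.Fin.Properties as Fin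
open import Data.Fin.Permutation using (_⟨$⟩ʳ_; _⟨$⟩ˡ_; inverseˡ; inverseʳ)
open import Data.Fin.Subset using (Subset; inside; outside; _⊆_; _⊂_; ∁; _∩_; _∪_; _─_; ⁅_⁆; ∣_∣)
  renaming (⊥ to ∅)
open import Data.Fin.Subset.Induction using (⊂-wellFounded; Acc; acc)
open import Data.Fin.Subset.Properties
  using (_∈?_; _⊆?_; _⊂?_; ⊆-antisym; ⊆-refl; ⊆-trans; ⊂-irref; p⊂q⇒p⊆q;
         p⊆q⇒∣p∣≤∣q∣; p⊆q⇒∁p⊇∁q; x∈p⇒x∉∁p; out⊆; in⊆in; s⊆s)
open import Data.Vec as Vec using (Vec; []; _∷_; lookup; removeAt; tabulate; replicate; toList)
open import Data.Vec.Properties using (≡-dec; lookup⇒[]=; []=⇒lookup; lookup∘tabulate; lookup-map)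
open import Data.Vec.Functional using (insertAt)
open import Data.Vec.Functional.Properties using (insertAt-lookup; insertAt-punchIn)
open import Data.List using (List; []; _∷_; map; _++_; filter; filterᵇ; allFin)
open import Data.List.Membership.Propositional using (_∈_; find; lose)
open import Data.List.Membership.Propositional.Properties
  using (∈-++⁺ˡ; ∈-++⁺ʳ; ∈-++⁻; ∈-map⁺; ∈-map⁻; ∈-filter⁺; ∈-filter⁻; ∈-allFin)
open import Data.List.Relation.Unary.All as All using (All; []; _∷_)
import Data.List.Relation.Unary.All.Properties as All
open import Data.List.Relation.Unary.Any as Any using (Any; any?; here; there)
open import Data.Product using (_×_; _,_; proj₁; proj₂; ∃-syntax)
import Data.Sum as Sum
open import Data.Sum using (_⊎_; inj₁; inj₂)
open import Function using (_∘_)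
open import Function.Bundles using (_↔_; Inverse; mk↔ₛ′; Equivalence)
open import Function.Construct.Composition using (_↔-∘_)
open import Relation.Binary.PropositionalEquality
open import Relation.Nullary using (¬_; Dec; yes; no; does)
open import Relation.Nullary.Decidable using (decidable-stable; ¬?; _⊎-dec_; isYes; toWitness; fromWitness)
open import Relation.Unary using (Decidable)
open import Algebra.Properties.CommutativeMonoid.Sum ℕ.+-0-commutativeMonoid
  using (sum; sum-remove; sum-cong-≗; sum-permute)

-- Nonnegative rationals and the ratio test.

0≤+ : ∀ {p q} → 0ℚ ≤ p → 0ℚ ≤ q → 0ℚ ≤ p + q
0≤+ = +-mono-≤

0≤* : ∀ {p q} → 0ℚ ≤ p → 0ℚ ≤ q → 0ℚ ≤ p * q
0≤* {p} {q} 0≤p 0≤q = subst (_≤ p * q) (*-zeroʳ p)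
  (*-monoˡ-≤-nonNeg p {{nonNegative 0≤p}} 0≤q)

-- Slacks `s` change at rates `δ` along a ray. The list is processed from the back: a constraint
-- violated at the current stopping time has a negative rate, and its own earlier zero becomes the
-- new stopping time.
ratioTest : ∀ {K : Set} (s δ : K → ℚ) (ks : List K) → (∀ {k} → k ∈ ks → 0ℚ ≤ s k) →
  (∀ {k} → k ∈ ks → 0ℚ ≤ δ k) ⊎
  ∃[ t ] 0ℚ ≤ t × (∀ {k} → k ∈ ks → 0ℚ ≤ s k + t * δ k)
       × ∃[ k ] k ∈ ks × δ k < 0ℚ × s k + t * δ k ≡ 0ℚ
ratioTest s δ [] _ = inj₁ λ ()
ratioTest {K} s δ (k ∷ ks) 0≤s = extend (ratioTest s δ ks (0≤s ∘ there)) (0ℚ ≤? δ k)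
  where
  Stop : ℚ → List K → Set
  Stop t js = 0ℚ ≤ t × (∀ {j} → j ∈ js → 0ℚ ≤ s j + t * δ j)
            × ∃[ j ] j ∈ js × δ j < 0ℚ × s j + t * δ j ≡ 0ℚ

  module _ (δ<0 : δ k < 0ℚ) where
    instance
      neg-δ = negative δ<0
      δ≢0 = neg⇒nonZero (δ k)

    τ : ℚ
    τ = s k * - (1/ δ k)

    vanishes : s k + τ * δ k ≡ 0ℚ
    vanishes = begin
      s k + s k * - (1/ δ k) * δ k    ≡⟨ solve 3 (λ a b c → a :+ a :* (:- b) :* c := a :+ :- (a :* (b :* c))) refl
                                         (s k) (1/ δ k) (δ k) ⟩
      s k + - (s k * (1/ δ k * δ k))  ≡⟨ cong (λ u → s k + - (s k * u)) (*-inverseˡ (δ k)) ⟩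
      s k + - (s k * 1ℚ)              ≡⟨ cong (λ u → s k + - u) (*-identityʳ (s k)) ⟩
      s k + - s k                     ≡⟨ +-inverseʳ (s k) ⟩
      0ℚ                              ∎
      where open ≡-Reasoning

    0≤τ : 0ℚ ≤ τ
    0≤τ = 0≤* (0≤s (here refl)) (<⇒≤ (neg-antimono-< (negative⁻¹ (1/ δ k) {{1/neg⇒neg (δ k)}})))

    stop : (∀ {j} → j ∈ ks → 0ℚ ≤ s j + τ * δ j) → Stop τ (k ∷ ks)
    stop feasible = 0≤τ , (λ { (here refl) → ≤-reflexive (sym vanishes) ; (there j∈) → feasible j∈ })
      , k , here refl , δ<0 , vanishes

  extend : (∀ {j} → j ∈ ks → 0ℚ ≤ δ j) ⊎ ∃[ t ] Stop t ks → _ →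
           (∀ {j} → j ∈ k ∷ ks → 0ℚ ≤ δ j) ⊎ ∃[ t ] Stop t (k ∷ ks)
  extend (inj₁ 0≤δ) (yes 0≤δk) = inj₁ λ { (here refl) → 0≤δk ; (there j∈) → 0≤δ j∈ }
  extend (inj₁ 0≤δ) (no δk≱0) = inj₂ (_ , stop δ<0 λ j∈ → 0≤+ (0≤s (there j∈)) (0≤* (0≤τ δ<0) (0≤δ j∈)))
    where δ<0 = ≰⇒> δk≱0
  extend (inj₂ (t , 0≤t , feasible , j , j∈ , δj<0 , sj≡0)) d with 0ℚ ≤? s k + t * δ k
  ... | yes ok = inj₂ (t , 0≤t , (λ { (here refl) → ok ; (there j∈) → feasible j∈ }) , j , there j∈ , δj<0 , sj≡0)
  ... | no ¬ok = inj₂ (_ , stop δ<0 earlier)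
    where
    δ<0 : δ k < 0ℚ
    δ<0 = ≰⇒> λ 0≤δ → ¬ok (0≤+ (0≤s (here refl)) (0≤* 0≤t 0≤δ))

    τ≤t : τ δ<0 ≤ t
    τ≤t = ≮⇒≥ λ t<τ → ¬ok (subst (_≤ s k + t * δ k) (vanishes δ<0)
      (+-monoʳ-≤ (s k) (*-monoʳ-≤-nonPos (δ k) {{nonPositive (<⇒≤ δ<0)}} (<⇒≤ t<τ))))

    earlier : ∀ {j} → j ∈ ks → 0ℚ ≤ s j + τ δ<0 * δ j
    earlier {j} j∈ with 0ℚ ≤? δ j
    ... | yes 0≤δ = 0≤+ (0≤s (there j∈)) (0≤* (0≤τ δ<0) 0≤δ)
    ... | no δ≱0 = ≤-trans (feasible j∈)
      (+-monoʳ-≤ (s j) (*-monoʳ-≤-nonPos (δ j) {{nonPositive (<⇒≤ (≰⇒> δ≱0))}} τ≤t))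

-- Linearity of sums, row sums and costs.

sumFin-cong : ∀ {n} {f g : Fin n → ℚ} → (∀ i → f i ≡ g i) → sumFin f ≡ sumFin g
sumFin-cong {zero}  f≗g = refl
sumFin-cong {suc n} f≗g = cong₂ _+_ (f≗g zero) (sumFin-cong (f≗g ∘ suc))

sumFin-mono : ∀ {n} {f g : Fin n → ℚ} → (∀ i → f i ≤ g i) → sumFin f ≤ sumFin g
sumFin-mono {zero}  f≤g = ≤-refl
sumFin-mono {suc n} f≤g = +-mono-≤ (f≤g zero) (sumFin-mono (f≤g ∘ suc))

comb : ∀ {n} → ℚ → (Fin n → ℚ) → ℚ → (Fin n → ℚ) → Fin n → ℚ
comb s x t y i = s * x i + t * y i

private
  regroup : ∀ s t a b u v → (s * a + t * b) + (s * u + t * v) ≡ s * (a + u) + t * (b + v)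
  regroup = solve 6 (λ s t a b u v → (s :* a :+ t :* b) :+ (s :* u :+ t :* v) := s :* (a :+ u) :+ t :* (b :+ v)) refl

  difference-self : ∀ a → 1ℚ * a + - 1ℚ * a ≡ 0ℚ
  difference-self = solve 1 (λ a → con 1ℚ :* a :+ con (- 1ℚ) :* a := con 0ℚ) refl

  midpoint-comm : ∀ {n} {x : Fin n → ℚ} (y z : Fin n → ℚ) → (∀ i → x i ≡ ½ * (y i + z i)) → ∀ i → x i ≡ ½ * (z i + y i)
  midpoint-comm y z mid i = trans (mid i) (cong (½ *_) (+-comm (y i) (z i)))

sumFin-comb : ∀ {n} s (x : Fin n → ℚ) t y → sumFin (comb s x t y) ≡ s * sumFin x + t * sumFin y
sumFin-comb {zero}  s x t y = sym (cong₂ _+_ (*-zeroʳ s) (*-zeroʳ t))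
sumFin-comb {suc n} s x t y = trans (cong (comb s x t y zero +_) (sumFin-comb s (x ∘ suc) t (y ∘ suc)))
  (regroup s t (x zero) (y zero) _ _)

rowSum-comb : ∀ {n} (H : Subset n) s x t y → rowSum H (comb s x t y) ≡ s * rowSum H x + t * rowSum H y
rowSum-comb []            s x t y = sym (cong₂ _+_ (*-zeroʳ s) (*-zeroʳ t))
rowSum-comb (inside ∷ H)  s x t y = trans (cong (comb s x t y zero +_) (rowSum-comb H s (x ∘ suc) t (y ∘ suc)))
  (regroup s t (x zero) (y zero) _ _)
rowSum-comb (outside ∷ H) s x t y = trans (+-identityˡ _) (trans (rowSum-comb H s (x ∘ suc) t (y ∘ suc))
  (sym (cong₂ _+_ (cong (s *_) (+-identityˡ _)) (cong (t *_) (+-identityˡ _)))))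

rowSum-cong : ∀ {n} (H : Subset n) {x y} → (∀ i → x i ≡ y i) → rowSum H x ≡ rowSum H y
rowSum-cong []            x≗y = refl
rowSum-cong (inside ∷ H)  x≗y = cong₂ _+_ (x≗y zero) (rowSum-cong H (x≗y ∘ suc))
rowSum-cong (outside ∷ H) x≗y = cong (0ℚ +_) (rowSum-cong H (x≗y ∘ suc))

cost : ∀ {n} → (Fin n → ℚ) → (Fin n → ℚ) → ℚ
cost c x = sumFin λ i → c i * x i

cost-comb : ∀ {n} (c : Fin n → ℚ) s x t y → cost c (comb s x t y) ≡ s * cost c x + t * cost c y
cost-comb c s x t y = trans
  (sumFin-cong λ i → solve 5 (λ c s a t b → c :* (s :* a :+ t :* b) := s :* (c :* a) :+ t :* (c :* b)) refl
                         (c i) s (x i) t (y i))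
  (sumFin-comb s (λ i → c i * x i) t (λ i → c i * y i))

-- Descent from a feasible point to a vertex.

module _ {n} (F : Family n) where

  Constraint : Set
  Constraint = Fin n ⊎ Subset n

  constraints : List Constraint
  constraints = map inj₁ (allFin n) ++ map inj₂ F

  value : Constraint → (Fin n → ℚ) → ℚ
  value (inj₁ i) x = x i
  value (inj₂ H) x = rowSum H x

  bound : Constraint → ℚ
  bound (inj₁ i) = 0ℚ
  bound (inj₂ H) = 1ℚ

  value-comb : ∀ k s x t y → value k (comb s x t y) ≡ s * value k x + t * value k y
  value-comb (inj₁ i) s x t y = refl
  value-comb (inj₂ H) s x t y = rowSum-comb H s x t y

  value-cong : ∀ k {x y} → (∀ i → x i ≡ y i) → value k x ≡ value k y
  value-cong (inj₁ i) x≗y = x≗y i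
  value-cong (inj₂ H) x≗y = rowSum-cong H x≗y

  Feasible : (Fin n → ℚ) → Set
  Feasible x = ∀ {k} → k ∈ constraints → bound k ≤ value k x

  coordinate∈ : ∀ i → inj₁ i ∈ constraints
  coordinate∈ i = ∈-++⁺ˡ (∈-map⁺ inj₁ (∈-allFin i))

  InP⇒Feasible : ∀ {x} → InP F x → Feasible x
  InP⇒Feasible (0≤x , rows) k∈ with ∈-++⁻ (map inj₁ (allFin n)) k∈
  ... | inj₁ i∈ with i , _ , refl ← ∈-map⁻ inj₁ i∈ = 0≤x i
  ... | inj₂ H∈ with H , H∈F , refl ← ∈-map⁻ inj₂ H∈ = rows H∈F

  Feasible⇒InP : ∀ {x} → Feasible x → InP F x
  Feasible⇒InP ok = (λ i → ok (coordinate∈ i)) , λ H∈ → ok (∈-++⁺ʳ (map inj₁ (allFin n)) (∈-map⁺ inj₂ H∈))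

  loose : (Fin n → ℚ) → Constraint → ℕ
  loose x k with value k x ≟ bound k
  ... | yes _ = 0
  ... | no  _ = 1

  looseCount : (Fin n → ℚ) → List Constraint → ℕ
  looseCount x []       = 0
  looseCount x (k ∷ ks) = loose x k ℕ.+ looseCount x ks

  Tighter : (Fin n → ℚ) → (Fin n → ℚ) → Constraint → Set
  Tighter x′ x k = value k x ≡ bound k → value k x′ ≡ bound k

  loose-mono : ∀ {x x′} k → Tighter x′ x k → loose x′ k ℕ.≤ loose x k
  loose-mono {x} {x′} k f with value k x ≟ bound k | value k x′ ≟ bound k
  ... | _     | yes _ = ℕ.z≤n
  ... | yes e | no ne = ⊥-elim (ne (f e))
  ... | no _  | no _  = ℕ.≤-refl

  loose-strict : ∀ {x x′} k → value k x ≢ bound k → value k x′ ≡ bound k → loose x′ k ℕ.< loose x k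
  loose-strict {x} {x′} k ne e with value k x ≟ bound k | value k x′ ≟ bound k
  ... | yes e′ | _      = ⊥-elim (ne e′)
  ... | no _   | yes _  = ℕ.≤-refl
  ... | no _   | no ne′ = ⊥-elim (ne′ e)

  looseCount-mono : ∀ {x x′} ks → (∀ {k} → k ∈ ks → Tighter x′ x k) → looseCount x′ ks ℕ.≤ looseCount x ks
  looseCount-mono []       f = ℕ.z≤n
  looseCount-mono (k ∷ ks) f = ℕ.+-mono-≤ (loose-mono k (f (here refl))) (looseCount-mono ks (f ∘ there))

  looseCount-strict : ∀ {x x′ k} ks → (∀ {k} → k ∈ ks → Tighter x′ x k) → k ∈ ks →
    value k x ≢ bound k → value k x′ ≡ bound k → looseCount x′ ks ℕ.< looseCount x ks
  looseCount-strict (k ∷ ks) f (here refl) ne e =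
    ℕ.+-mono-<-≤ (loose-strict k ne e) (looseCount-mono ks (f ∘ there))
  looseCount-strict (k ∷ ks) f (there k∈) ne e =
    ℕ.+-mono-≤-< (loose-mono k (f (here refl))) (looseCount-strict ks (f ∘ there) k∈ ne e)

  module _ (c : Fin n → ℚ) (0≤c : ∀ i → 0ℚ ≤ c i) where

    Better : (Fin n → ℚ) → Set
    Better x = ∃[ x′ ] InP F x′ × cost c x′ ≤ cost c x × looseCount x′ constraints ℕ.< looseCount x constraints

    -- As `d` vanishes on the tight constraints, they stay tight along it. The ratio test either
    -- stops at a newly tight constraint or finds `d` nonnegative on all constraints, in particular
    -- on the coordinates.
    move : ∀ {x} d → InP F x → cost c d ≤ 0ℚ →
      (∀ {k} → k ∈ constraints → value k x ≡ bound k → value k d ≡ 0ℚ) →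
      Better x ⊎ (∀ i → 0ℚ ≤ d i)
    move {x} d x∈P cd≤0 tight with ratioTest (λ k → value k x - bound k) (λ k → value k d) constraints
      (λ {k} k∈ → subst (_≤ value k x - bound k) (+-inverseʳ (bound k)) (+-monoˡ-≤ (- bound k) (InP⇒Feasible x∈P k∈)))
    ... | inj₁ 0≤d = inj₂ λ i → 0≤d (coordinate∈ i)
    ... | inj₂ (t , 0≤t , feasible , k , k∈ , d<0 , hit) = inj₁ (x′ , Feasible⇒InP feasible′ , cheaper
        , looseCount-strict constraints stays k∈ (λ e → <-irrefl (tight k∈ e) d<0) (equal k hit))
      where
      x′ = comb 1ℚ x t d

      slack′ : ∀ k → value k x′ ≡ (value k x - bound k + t * value k d) + bound k
      slack′ k = trans (value-comb k 1ℚ x t d)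
        (solve 4 (λ a b t u → con 1ℚ :* a :+ t :* u := (a :+ :- b :+ t :* u) :+ b) refl
          (value k x) (bound k) t (value k d))

      equal : ∀ k → value k x - bound k + t * value k d ≡ 0ℚ → value k x′ ≡ bound k
      equal k e = trans (slack′ k) (trans (cong (_+ bound k) e) (+-identityˡ _))

      feasible′ : Feasible x′
      feasible′ {k} k∈ = subst₂ _≤_ (+-identityˡ (bound k)) (sym (slack′ k)) (+-monoˡ-≤ (bound k) (feasible k∈))

      cheaper : cost c x′ ≤ cost c x
      cheaper = begin
        cost c x′                     ≡⟨ cost-comb c 1ℚ x t d ⟩
        1ℚ * cost c x + t * cost c d  ≤⟨ +-monoʳ-≤ (1ℚ * cost c x) (*-monoˡ-≤-nonNeg t {{nonNegative 0≤t}} cd≤0) ⟩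
        1ℚ * cost c x + t * 0ℚ        ≡⟨ solve 2 (λ a t → con 1ℚ :* a :+ t :* con 0ℚ := a) refl (cost c x) t ⟩
        cost c x                      ∎
        where open ≤-Reasoning

      stays : ∀ {k} → k ∈ constraints → Tighter x′ x k
      stays {k} k∈ e = equal k (trans (cong₂ (λ u v → u - bound k + t * v) e (tight k∈ e))
        (solve 2 (λ b t → b :+ :- b :+ t :* con 0ℚ := con 0ℚ) refl (bound k) t))

    toward : (Fin n → ℚ) → (Fin n → ℚ) → Fin n → ℚ
    toward y z = comb 1ℚ z (- 1ℚ) y

    toward-cost : ∀ y z → cost c z ≤ cost c y → cost c (toward y z) ≤ 0ℚ
    toward-cost y z cz≤cy = begin
      cost c (toward y z)                   ≡⟨ cost-comb c 1ℚ z (- 1ℚ) y ⟩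
      1ℚ * cost c z + - 1ℚ * cost c y       ≤⟨ +-monoˡ-≤ (- 1ℚ * cost c y) (*-monoˡ-≤-nonNeg 1ℚ cz≤cy) ⟩
      1ℚ * cost c y + - 1ℚ * cost c y       ≡⟨ difference-self (cost c y) ⟩
      0ℚ                                    ∎
      where open ≤-Reasoning

    toward-nonNeg : ∀ y z i → 0ℚ ≤ toward y z i → y i ≤ z i
    toward-nonNeg y z i 0≤d = subst₂ _≤_ (+-identityˡ (y i))
      (solve 2 (λ y z → con 1ℚ :* z :+ con (- 1ℚ) :* y :+ y := z) refl (y i) (z i)) (+-monoˡ-≤ (y i) 0≤d)

    -- Both values are at least the bound, and their mean equals it.
    midpoint-tight : ∀ {x} y z → (∀ i → x i ≡ ½ * (y i + z i)) → InP F y → InP F z →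
      ∀ {k} → k ∈ constraints → value k x ≡ bound k → value k y ≡ bound k × value k z ≡ bound k
    midpoint-tight {x} y z mid y∈P z∈P {k} k∈ e =
        ≤-antisym (upper y z halves z∈P) (InP⇒Feasible y∈P k∈)
      , ≤-antisym (upper z y (trans halves (+-comm (½ * value k y) (½ * value k z))) y∈P) (InP⇒Feasible z∈P k∈)
      where
      halves : bound k ≡ ½ * value k y + ½ * value k z
      halves = trans (sym e) (trans (value-cong k λ i → trans (mid i) (*-distribˡ-+ ½ (y i) (z i)))
        (value-comb k ½ y ½ z))

      upper : ∀ y z → bound k ≡ ½ * value k y + ½ * value k z → InP F z → value k y ≤ bound k
      upper y z h z∈P = begin
        value k y                           ≡⟨ solve 2 (λ y z → y := (con ½ :* y :+ con ½ :* z) :+ (con ½ :* y :+ con ½ :* z) :+ :- z)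
                                                 refl (value k y) (value k z) ⟩
        _                                   ≡⟨ cong (λ u → u + u - value k z) h ⟨
        bound k + bound k - value k z       ≤⟨ +-monoʳ-≤ (bound k + bound k) (neg-antimono-≤ (InP⇒Feasible z∈P k∈)) ⟩
        bound k + bound k - bound k         ≡⟨ solve 1 (λ b → b :+ b :+ :- b := b) refl (bound k) ⟩
        bound k                             ∎
        where open ≤-Reasoning

    moveToward : ∀ {x} y z → InP F x → InP F y → InP F z → (∀ i → x i ≡ ½ * (y i + z i)) →
      cost c z ≤ cost c y → Better x ⊎ (∀ i → y i ≤ z i)
    moveToward {x} y z x∈P y∈P z∈P mid cz≤cy =
      Sum.map₂ (λ 0≤d i → toward-nonNeg y z i (0≤d i)) (move (toward y z) x∈P (toward-cost y z cz≤cy) flat)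
      where
      flat : ∀ {k} → k ∈ constraints → value k x ≡ bound k → value k (toward y z) ≡ 0ℚ
      flat {k} k∈ e = trans (value-comb k 1ℚ z (- 1ℚ) y)
        (trans (cong₂ (λ u v → 1ℚ * u + - 1ℚ * v) (proj₂ both) (proj₁ both)) (difference-self (bound k)))
        where both = midpoint-tight y z mid y∈P z∈P k∈ e

    cost-mono : ∀ {y z} → (∀ i → y i ≤ z i) → cost c y ≤ cost c z
    cost-mono y≤z = sumFin-mono λ i → *-monoˡ-≤-nonNeg (c i) {{nonNegative (0≤c i)}} (y≤z i)

    -- If the walk in direction `z - y` is never blocked, then `y ≤ z`, so `y` costs no more than
    -- `z`. The reverse walk is then allowed too and gives `z ≤ y`.
    improveToward : ∀ {x} y z → InP F x → InP F y → InP F z → (∀ i → x i ≡ ½ * (y i + z i)) →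
      cost c z ≤ cost c y → Better x ⊎ (∀ i → y i ≡ z i)
    improveToward y z x∈P y∈P z∈P mid cz≤cy = Sum.[ inj₁ , back ]′ (moveToward y z x∈P y∈P z∈P mid cz≤cy)
      where
      back : (∀ i → y i ≤ z i) → _ ⊎ (∀ i → y i ≡ z i)
      back y≤z = Sum.map₂ (λ z≤y i → ≤-antisym (y≤z i) (z≤y i))
        (moveToward z y x∈P z∈P y∈P (midpoint-comm y z mid) (cost-mono y≤z))

    improve : ∀ {x} y z → InP F x → InP F y → InP F z → (∀ i → x i ≡ ½ * (y i + z i)) →
      Better x ⊎ (∀ i → y i ≡ z i)
    improve y z x∈P y∈P z∈P mid = Sum.[ improveToward y z x∈P y∈P z∈P mid , flipped ]′ (≤-total (cost c z) (cost c y))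
      where
      flipped : cost c y ≤ cost c z → _ ⊎ (∀ i → y i ≡ z i)
      flipped cy≤cz = Sum.map₂ (λ z≗y i → sym (z≗y i)) (improveToward z y x∈P z∈P y∈P (midpoint-comm y z mid) cy≤cz)

    -- Each improving move keeps the tight constraints tight and makes a further one tight.
    vertexBelow : ∀ {x} → InP F x → ¬ ¬ (∃[ y ] IsVertex F y × cost c y ≤ cost c x)
    vertexBelow {x} x∈P = go (suc (looseCount x constraints)) x x∈P ℕ.≤-refl
      where
      go : ∀ fuel x → InP F x → looseCount x constraints ℕ.< fuel → ¬ ¬ (∃[ y ] IsVertex F y × cost c y ≤ cost c x)
      go (suc fuel) x x∈P (ℕ.s≤s count≤fuel) none = none (x , (x∈P , extreme) , ≤-refl)
        where
        descend : ¬ Better x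
        descend (x′ , x′∈P , c′≤c , fewer) = go fuel x′ x′∈P (ℕ.≤-trans fewer count≤fuel)
          λ (v , vertex , cv≤c′) → none (v , vertex , ≤-trans cv≤c′ c′≤c)

        -- Extremality is not decided: `none` refutes every improvement, so `improve` can only
        -- return equality. This is the source of the double negation.
        extreme : ∀ y z → InP F y → InP F z → (∀ i → x i ≡ ½ * (y i + z i)) → ∀ i → y i ≡ z i
        extreme y z y∈P z∈P mid = Sum.[ ⊥-elim ∘ descend , (λ y≗z → y≗z) ]′ (improve y z x∈P y∈P z∈P mid)

-- Natural numbers as rationals, and scaled integer vectors.

ι : ℕ → ℚ
ι zero    = 0ℚ
ι (suc n) = 1ℚ + ι n

ι-+ : ∀ m n → ι (m ℕ.+ n) ≡ ι m + ι n
ι-+ zero    n = sym (+-identityˡ (ι n))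
ι-+ (suc m) n = trans (cong (1ℚ +_) (ι-+ m n)) (sym (+-assoc 1ℚ (ι m) (ι n)))

ι-* : ∀ m n → ι (m ℕ.* n) ≡ ι m * ι n
ι-* zero    n = sym (*-zeroˡ (ι n))
ι-* (suc m) n = begin
  ι (n ℕ.+ m ℕ.* n)   ≡⟨ ι-+ n (m ℕ.* n) ⟩
  ι n + ι (m ℕ.* n)   ≡⟨ cong₂ _+_ (sym (*-identityˡ (ι n))) (ι-* m n) ⟩
  1ℚ * ι n + ι m * ι n ≡⟨ *-distribʳ-+ (ι n) 1ℚ (ι m) ⟨
  (1ℚ + ι m) * ι n    ∎
  where open ≡-Reasoning

0≤1 : 0ℚ ≤ 1ℚ
0≤1 = ≤ᵇ⇒≤ _

ι-nonNeg : ∀ n → 0ℚ ≤ ι n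
ι-nonNeg zero    = ≤-refl
ι-nonNeg (suc n) = 0≤+ 0≤1 (ι-nonNeg n)

ι-mono : ∀ {m n} → m ℕ.≤ n → ι m ≤ ι n
ι-mono {n = n} ℕ.z≤n = ι-nonNeg n
ι-mono (ℕ.s≤s m≤n)   = +-monoʳ-≤ 1ℚ (ι-mono m≤n)

ι<ι-suc : ∀ n → ι n < ι (suc n)
ι<ι-suc n = subst (_< 1ℚ + ι n) (+-identityˡ (ι n)) (+-monoˡ-< (ι n) (positive⁻¹ 1ℚ))

ι-cancel : ∀ {m n} → ι m ≤ ι n → m ℕ.≤ n
ι-cancel {m} {n} ιm≤ιn = ℕ.≮⇒≥ λ n<m → <-irrefl refl
  (<-≤-trans (ι<ι-suc n) (≤-trans (ι-mono n<m) ιm≤ιn))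

ι-sum : ∀ {n} (f : Fin n → ℕ) → ι (sum f) ≡ sumFin (ι ∘ f)
ι-sum {zero}  f = refl
ι-sum {suc n} f = trans (ι-+ (f zero) _) (cong (ι (f zero) +_) (ι-sum (f ∘ suc)))

reciprocal : ∀ q → .{{ℕ.NonZero q}} → ∃[ r ] 0ℚ ≤ r × ι q * r ≡ 1ℚ
reciprocal (suc q) = 1/ ι (suc q) , <⇒≤ (positive⁻¹ (1/ ι (suc q)) {{1/pos⇒pos (ι (suc q))}}) , *-inverseʳ (ι (suc q))
  where instance
    ι-positive : Positive (ι (suc q))
    ι-positive = positive (≤-<-trans (ι-nonNeg q) (ι<ι-suc q))
    ι-nonZero : NonZero (ι (suc q))
    ι-nonZero = pos⇒nonZero (ι (suc q))

weight : ∀ {n} → (Fin n → ℕ) → (Fin n → Bool) → ℕ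
weight w b = sum λ i → if b i then w i else 0

total : ∀ {n} → (Fin n → ℕ) → (Fin n → ℕ) → ℕ
total c x = sum λ i → c i ℕ.* x i

scale : ∀ {n} → (Fin n → ℕ) → ℚ → Fin n → ℚ
scale x r i = ι (x i) * r

rowSum-scale : ∀ {n} (H : Subset n) x r → rowSum H (scale x r) ≡ ι (weight x (lookup H)) * r
rowSum-scale []            x r = sym (*-zeroˡ r)
rowSum-scale (inside ∷ H)  x r = trans (cong (ι (x zero) * r +_) (rowSum-scale H (x ∘ suc) r))
  (trans (sym (*-distribʳ-+ r (ι (x zero)) _)) (cong (_* r) (sym (ι-+ (x zero) _))))
rowSum-scale (outside ∷ H) x r = trans (+-identityˡ _) (rowSum-scale H (x ∘ suc) r)

cost-scale : ∀ {n} (c x : Fin n → ℕ) r → cost (ι ∘ c) (scale x r) ≡ ι (total c x) * r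
cost-scale {zero}  c x r = sym (*-zeroˡ r)
cost-scale {suc n} c x r = begin
  ι (c zero) * (ι (x zero) * r) + cost (ι ∘ c ∘ suc) (scale (x ∘ suc) r)
    ≡⟨ cong₂ _+_ (sym (*-assoc (ι (c zero)) (ι (x zero)) r)) (cost-scale (c ∘ suc) (x ∘ suc) r) ⟩
  ι (c zero) * ι (x zero) * r + ι (total (c ∘ suc) (x ∘ suc)) * r
    ≡⟨ *-distribʳ-+ r (ι (c zero) * ι (x zero)) _ ⟨
  (ι (c zero) * ι (x zero) + ι (total (c ∘ suc) (x ∘ suc))) * r
    ≡⟨ cong (λ u → (u + ι (total (c ∘ suc) (x ∘ suc))) * r) (sym (ι-* (c zero) (x zero))) ⟩
  (ι (c zero ℕ.* x zero) + ι (total (c ∘ suc) (x ∘ suc))) * r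
    ≡⟨ cong (_* r) (sym (ι-+ (c zero ℕ.* x zero) _)) ⟩
  ι (total c x) * r ∎
  where open ≡-Reasoning

integral≥1 : ∀ k → 0ℚ ≤ k / 1 → k / 1 ≢ 0ℚ → 1ℚ ≤ k / 1
integral≥1 (ℤ.+ zero)  _ k≢0 = ⊥-elim (k≢0 refl)
integral≥1 (ℤ.+ suc n) _ _   = toℚᵘ-cancel-≤ (ℚᵘ.≤-respʳ-≃ (ℚᵘ.≃-sym (toℚᵘ-fromℚᵘ (ℚᵘ.mkℚᵘ (ℤ.+ suc n) 0)))
  (ℚᵘ.*≤* (+≤+ (ℕ.s≤s ℕ.z≤n))))
integral≥1 -[1+ n ] 0≤k _ with ℚᵘ.*≤* () ← ℚᵘ.≤-respʳ-≃ (toℚᵘ-fromℚᵘ (ℚᵘ.mkℚᵘ -[1+ n ] 0)) (toℚᵘ-mono-≤ 0≤k)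

support : ∀ {n} → (Fin n → ℚ) → Fin n → Bool
support y i = not (does (y i ≟ 0ℚ))

-- A nonzero coordinate of a nonnegative integral vector is at least 1.
weight-support : ∀ {n} (c : Fin n → ℕ) {y} → (∀ i → 0ℚ ≤ y i) → Integral y →
  ι (weight c (support y)) ≤ cost (ι ∘ c) y
weight-support {n} c {y} 0≤y int = subst (_≤ cost (ι ∘ c) y) (sym (ι-sum {n} _)) (sumFin-mono term)
  where
  1≤ : ∀ i → y i ≢ 0ℚ → 1ℚ ≤ y i
  1≤ i y≢0 = let (k , y≡k) = int i in
    subst (1ℚ ≤_) (sym y≡k) (integral≥1 k (subst (0ℚ ≤_) y≡k (0≤y i)) (subst (_≢ 0ℚ) y≡k y≢0))

  term : ∀ i → ι (if support y i then c i else 0) ≤ ι (c i) * y i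
  term i with y i ≟ 0ℚ
  ... | yes _  = 0≤* (ι-nonNeg (c i)) (0≤y i)
  ... | no y≢0 = subst (_≤ ι (c i) * y i) (*-identityʳ (ι (c i)))
    (*-monoˡ-≤-nonNeg (ι (c i)) {{nonNegative (ι-nonNeg (c i))}} (1≤ i y≢0))

-- Cheap transversals from ideality.

Meets : ∀ {n} → (Fin n → Bool) → Subset n → Set
Meets b H = ∃[ i ] lookup H i ≡ true × b i ≡ true

Transversal : ∀ {n} → Family n → (Fin n → Bool) → Set
Transversal F b = ∀ {H} → H ∈ F → Meets b H

support-meets : ∀ {n} (H : Subset n) y → rowSum H y ≢ 0ℚ → Meets (support y) H
support-meets []            y ≢0 = ⊥-elim (≢0 refl)
support-meets (outside ∷ H) y ≢0 =
  let (i , i∈H , i∈b) = support-meets H (y ∘ suc) (≢0 ∘ trans (+-identityˡ _)) in suc i , i∈H , i∈b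
support-meets (inside ∷ H)  y ≢0 with support-meets H (y ∘ suc) | y zero ≟ 0ℚ in eq
... | rest | yes y₀≡0 =
  let (i , i∈H , i∈b) = rest (λ e → ≢0 (trans (cong₂ _+_ y₀≡0 e) (+-identityˡ _))) in suc i , i∈H , i∈b
... | rest | no _ = zero , refl , cong (not ∘ does) eq

-- The point `x / q` is feasible and costs less than `k`. A vertex costing no more is integral, and
-- its support is a transversal that is no dearer.
idealTransversal : ∀ {n} (F : Family n) → Ideal F → (x c : Fin n → ℕ) (q k : ℕ) →
  (∀ {H} → H ∈ F → q ℕ.≤ weight x (lookup H)) → total c x ℕ.< q ℕ.* k →
  ¬ ¬ (∃[ b ] Transversal F b × weight c b ℕ.< k)
idealTransversal F ideal x c zero    k _ ()
idealTransversal F ideal x c q@(suc _) k heavy cheap none with r , 0≤r , qr≡1 ← reciprocal q =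
  vertexBelow F (ι ∘ c) (ι-nonNeg ∘ c) scaled λ (y , vertex@((0≤y , rows) , _) , cy≤cx) →
    none ( support y
         , (λ {H} H∈ → support-meets H y λ e → <-irrefl refl (≤-<-trans (rows H∈) (subst (_< 1ℚ) (sym e) (positive⁻¹ 1ℚ))))
         , ℕ.*-cancelˡ-< q _ _ (ℕ.≤-<-trans (bound′ y 0≤y (ideal y vertex) cy≤cx) cheap))
  where
  scaled : InP F (scale x r)
  scaled = (λ i → 0≤* (ι-nonNeg (x i)) 0≤r) , λ {H} H∈ → subst₂ _≤_ qr≡1 (sym (rowSum-scale H x r))
    (*-monoʳ-≤-nonNeg r {{nonNegative 0≤r}} (ι-mono (heavy H∈)))

  bound′ : ∀ y → (∀ i → 0ℚ ≤ y i) → Integral y → cost (ι ∘ c) y ≤ cost (ι ∘ c) (scale x r) →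
    q ℕ.* weight c (support y) ℕ.≤ total c x
  bound′ y 0≤y int cy≤cx = ι-cancel (begin
    ι (q ℕ.* weight c (support y))  ≡⟨ ι-* q (weight c (support y)) ⟩
    ι q * ι (weight c (support y))  ≤⟨ *-monoˡ-≤-nonNeg (ι q) {{nonNegative (ι-nonNeg q)}}
                                         (≤-trans (weight-support c 0≤y int) cy≤cx) ⟩
    ι q * cost (ι ∘ c) (scale x r)  ≡⟨ cong (ι q *_) (cost-scale c x r) ⟩
    ι q * (ι (total c x) * r)       ≡⟨ solve 3 (λ q t r → q :* (t :* r) := t :* (q :* r)) refl (ι q) (ι (total c x)) r ⟩
    ι (total c x) * (ι q * r)       ≡⟨ cong (ι (total c x) *_) qr≡1 ⟩
    ι (total c x) * 1ℚ              ≡⟨ *-identityʳ _ ⟩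
    ι (total c x)                   ∎)
    where open ≤-Reasoning

-- Deletions and contractions.

lookup-removeAt : ∀ {n} (H : Subset (suc n)) v j → lookup (removeAt H v) j ≡ lookup H (punchIn v j)
lookup-removeAt (_ ∷ H)         zero    j       = refl
lookup-removeAt (_ ∷ H@(_ ∷ _)) (suc v) zero    = refl
lookup-removeAt (_ ∷ H@(_ ∷ _)) (suc v) (suc j) = lookup-removeAt H v j

⊆∧⊄⇒≡ : ∀ {n} (p q : Subset n) → p ⊆ q → ¬ p ⊂ q → p ≡ q
⊆∧⊄⇒≡ p q p⊆q p⊄q = ⊆-antisym p⊆q λ {x} x∈q → decidable-stable (x ∈? p) λ x∉p → p⊄q (p⊆q , x , x∈q , x∉p)

module _ {n} (E : Family (suc n)) (v : Fin (suc n)) where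

  deletion : Family n
  deletion = map (λ H → removeAt H v) (filter (λ H → lookup H v Bool.≟ outside) E)

  deletion-isDeletion : IsDeletion E v deletion
  deletion-isDeletion G = to , from
    where
    to : G ∈ deletion → _
    to G∈ with H , H∈ , refl ← ∈-map⁻ _ G∈ with H∈E , out ← ∈-filter⁻ _ H∈ = H , H∈E , out , refl
    from : _ → G ∈ deletion
    from (H , H∈E , out , refl) = ∈-map⁺ _ (∈-filter⁺ _ H∈E out)

  shadows : Family n
  shadows = map (λ H → removeAt H v) E

  shadow⇒∈ : ∀ {G} → Shadow E v G → G ∈ shadows
  shadow⇒∈ (H , H∈E , refl) = ∈-map⁺ _ H∈E

  ∈⇒shadow : ∀ {G} → G ∈ shadows → Shadow E v G
  ∈⇒shadow G∈ with H , H∈E , refl ← ∈-map⁻ _ G∈ = H , H∈E , refl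

  minimal? : ∀ G → Dec (¬ Any (_⊂ G) shadows)
  minimal? G = ¬? (any? (_⊂? G) shadows)

  contraction : Family n
  contraction = filter minimal? shadows

  contraction-isContraction : IsContraction E v contraction
  contraction-isContraction G = to , from
    where
    MinimalShadow : Set
    MinimalShadow = Shadow E v G × (∀ G′ → Shadow E v G′ → G′ ⊆ G → G′ ≡ G)

    to : G ∈ contraction → MinimalShadow
    to G∈ with G∈s , min ← ∈-filter⁻ minimal? {xs = shadows} G∈ =
      ∈⇒shadow G∈s , λ G′ s G′⊆G → ⊆∧⊄⇒≡ G′ G G′⊆G λ G′⊂G → min (lose (shadow⇒∈ s) G′⊂G)
    from : MinimalShadow → G ∈ contraction
    from (s , min) = ∈-filter⁺ minimal? (shadow⇒∈ s) λ smaller →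
      let (G′ , G′∈ , G′⊂G) = find smaller
      in ⊂-irref (min G′ (∈⇒shadow G′∈) (p⊂q⇒p⊆q G′⊂G)) G′⊂G

  -- The contraction keeps only minimal shadows, but its transversals have to meet every shadow.
  minimalShadow : ∀ {G} → G ∈ shadows → ∃[ G₀ ] G₀ ∈ contraction × G₀ ⊆ G
  minimalShadow {G} = go (⊂-wellFounded G)
    where
    go : ∀ {G} → Acc _⊂_ G → G ∈ shadows → ∃[ G₀ ] G₀ ∈ contraction × G₀ ⊆ G
    go {G} (acc rs) G∈ with any? (_⊂? G) shadows
    ... | no min = G , ∈-filter⁺ minimal? G∈ min , ⊆-refl
    ... | yes smaller with G′ , G′∈ , G′⊂G ← find smaller with G₀ , G₀∈ , G₀⊆G′ ← go (rs G′⊂G) G′∈ =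
      G₀ , G₀∈ , ⊆-trans G₀⊆G′ (p⊂q⇒p⊆q G′⊂G)

  weight-lookup : ∀ w H → weight w (lookup H) ≡
    (if lookup H v then w v else 0) ℕ.+ weight (w ∘ punchIn v) (lookup (removeAt H v))
  weight-lookup w H = trans (sum-remove {i = v} λ i → if lookup H i then w i else 0)
    (cong₂ ℕ._+_ refl (sum-cong-≗ λ j → cong (if_then w (punchIn v j) else 0) (sym (lookup-removeAt H v j))))

  weight-insertAt : ∀ c b a → weight c (insertAt b v a) ≡ (if a then c v else 0) ℕ.+ weight (c ∘ punchIn v) b
  weight-insertAt c b a = trans (sum-remove {i = v} λ i → if insertAt b v a i then c i else 0)
    (cong₂ ℕ._+_ (cong (if_then c v else 0) (insertAt-lookup b v a))
      (sum-cong-≗ λ j → cong (if_then c (punchIn v j) else 0) (insertAt-punchIn b v a j)))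

  total-remove : ∀ c x → total (c ∘ punchIn v) (x ∘ punchIn v) ℕ.≤ total c x
  total-remove c x = subst (total (c ∘ punchIn v) (x ∘ punchIn v) ℕ.≤_)
    (sym (sum-remove {i = v} λ i → c i ℕ.* x i)) (ℕ.m≤n+m _ _)

  meets-insertAt : ∀ {b a H} → Meets b (removeAt H v) → Meets (insertAt b v a) H
  meets-insertAt {b} {a} {H} (j , j∈H , j∈b) =
    punchIn v j , trans (sym (lookup-removeAt H v j)) j∈H , trans (insertAt-punchIn b v a j) j∈b

  -- If `c v = 0`, delete `v`; it then joins the transversal at no cost. If `x v = 0`, contract `v`;
  -- edges lose no weight, and the transversal leaves `v` out.
  cheapTransversal : (∀ {k} (F : Family k) → ProperMinor E F → Ideal F) →
    (x c : Fin (suc n) → ℕ) (q k : ℕ) → c v ≡ 0 ⊎ x v ≡ 0 →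
    (∀ {H} → H ∈ E → q ℕ.≤ weight x (lookup H)) → total c x ℕ.< q ℕ.* k →
    ¬ ¬ (∃[ b ] Transversal E b × weight c b ℕ.< k)
  cheapTransversal ideal x c q k (inj₁ cv≡0) heavy cheap none =
    idealTransversal deletion (ideal deletion (del v deletion-isDeletion here))
      (x ∘ punchIn v) (c ∘ punchIn v) q k heavy′ (ℕ.≤-<-trans (total-remove c x) cheap)
      λ (b , meets , light) → none (insertAt b v true , (λ H∈E → meets′ b meets H∈E) ,
        subst (ℕ._< k) (sym (trans (weight-insertAt c b true) (cong₂ ℕ._+_ cv≡0 refl))) light)
    where
    heavy′ : ∀ {G} → G ∈ deletion → q ℕ.≤ weight (x ∘ punchIn v) (lookup G)
    heavy′ G∈ with H , H∈E , out , refl ← proj₁ (deletion-isDeletion _) G∈ =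
      subst (q ℕ.≤_) (trans (weight-lookup x H) (cong₂ (λ a u → (if a then x v else 0) ℕ.+ u) out refl)) (heavy H∈E)

    meets′ : ∀ b → Transversal deletion b → Transversal E (insertAt b v true)
    meets′ b meets {H} H∈E with lookup H v in eq
    ... | true  = v , eq , insertAt-lookup b v true
    ... | false = meets-insertAt {H = H} (meets (proj₂ (deletion-isDeletion _) (H , H∈E , eq , refl)))
  cheapTransversal ideal x c q k (inj₂ xv≡0) heavy cheap none =
    idealTransversal contraction (ideal contraction (con v contraction-isContraction here))
      (x ∘ punchIn v) (c ∘ punchIn v) q k heavy′ (ℕ.≤-<-trans (total-remove c x) cheap)
      λ (b , meets , light) → none (insertAt b v false , (λ H∈E → meets′ b meets H∈E) ,
        subst (ℕ._< k) (sym (weight-insertAt c b false)) light)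
    where
    heavy′ : ∀ {G} → G ∈ contraction → q ℕ.≤ weight (x ∘ punchIn v) (lookup G)
    heavy′ G∈ with (H , H∈E , refl) , _ ← proj₁ (contraction-isContraction _) G∈ =
      subst (q ℕ.≤_) (trans (weight-lookup x H) (cong₂ ℕ._+_ (vanish (lookup H v)) refl)) (heavy H∈E)
      where
      vanish : ∀ a → (if a then x v else 0) ≡ 0
      vanish true  = xv≡0
      vanish false = refl

    meets′ : ∀ b → Transversal contraction b → Transversal E (insertAt b v false)
    meets′ b meets {H} H∈E with G₀ , G₀∈ , G₀⊆ ← minimalShadow (shadow⇒∈ (H , H∈E , refl))
      with j , j∈G₀ , j∈b ← meets G₀∈ =
      meets-insertAt {H = H} (j , []=⇒lookup (G₀⊆ (lookup⇒[]= j G₀ j∈G₀)) , j∈b)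

-- Coordinates for the plane.

points : Vec PGPoint 13
points = Vec.map (λ bc → (1F , bc) , inj₁ refl) (Vec.allPairs (Vec.allFin 3) (Vec.allFin 3))
  Vec.++ Vec.map (λ c → (0F , 1F , c) , inj₂ (inj₁ (refl , refl))) (Vec.allFin 3)
  Vec.++ ((0F , 0F , 1F) , inj₂ (inj₂ (refl , refl , refl))) ∷ []

index : PGPoint → Fin 13
index ((_ , b , c) , inj₁ _)        = Fin.join 9 4 (inj₁ (Fin.combine b c))
index ((_ , _ , c) , inj₂ (inj₁ _)) = Fin.join 9 4 (inj₂ (c Fin.↑ˡ 1))
index (_           , inj₂ (inj₂ _)) = Fin.join 9 4 (inj₂ 3F)

lookup-index : ∀ p → lookup points (index p) ≡ p
lookup-index ((_ , 0F , 0F) , inj₁ refl) = refl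
lookup-index ((_ , 0F , 1F) , inj₁ refl) = refl
lookup-index ((_ , 0F , 2F) , inj₁ refl) = refl
lookup-index ((_ , 1F , 0F) , inj₁ refl) = refl
lookup-index ((_ , 1F , 1F) , inj₁ refl) = refl
lookup-index ((_ , 1F , 2F) , inj₁ refl) = refl
lookup-index ((_ , 2F , 0F) , inj₁ refl) = refl
lookup-index ((_ , 2F , 1F) , inj₁ refl) = refl
lookup-index ((_ , 2F , 2F) , inj₁ refl) = refl
lookup-index ((_ , _ , 0F) , inj₂ (inj₁ (refl , refl))) = refl
lookup-index ((_ , _ , 1F) , inj₂ (inj₁ (refl , refl))) = refl
lookup-index ((_ , _ , 2F) , inj₂ (inj₁ (refl , refl))) = refl
lookup-index (_ , inj₂ (inj₂ (refl , refl , refl))) = refl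

index-lookup : ∀ i → index (lookup points i) ≡ i
index-lookup = toWitness {a? = Fin.all? λ i → index (lookup points i) Fin.≟ i} _

onLine? : ∀ p ℓ → Dec (OnLine p ℓ)
onLine? p ℓ = _ ℕ.≟ _

lineSet : PGLine → Subset 13
lineSet ℓ = Vec.map (λ p → isYes (onLine? p ℓ)) points

lines : List (Subset 13)
lines = map lineSet (toList points)

-- Checking certificates by enumeration.

Antitone : ∀ {n} → (Subset n → Set) → Set
Antitone P = ∀ {U V} → U ⊆ V → P V → P U

-- Meant for antitone P: weightless elements are only tried inside.
holdsBelow : ∀ {n} {P : Subset n → Set} → Vec ℕ n → ℕ → Decidable P → Bool
holdsBelow []           k P? = isYes (P? [])
holdsBelow (zero  ∷ ws) k P? = holdsBelow ws k (P? ∘ (inside ∷_))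
holdsBelow (suc w ∷ ws) k P? = holdsBelow ws k (P? ∘ (outside ∷_))
  ∧ (if suc w ℕ.<ᵇ k then holdsBelow ws (k ℕ.∸ suc w) (P? ∘ (inside ∷_)) else true)

holdsBelow-sound : ∀ {n} {P : Subset n → Set} (ws : Vec ℕ n) k (P? : Decidable P) → Antitone P →
  T (holdsBelow ws k P?) → ∀ U → weight (lookup ws) (lookup U) ℕ.< k → P U
holdsBelow-sound [] k P? anti t [] _ = toWitness {a? = P? []} t
holdsBelow-sound (zero ∷ ws) k P? anti t (inside ∷ U) w<k = holdsBelow-sound ws k _ (anti ∘ in⊆in) t U w<k
holdsBelow-sound (zero ∷ ws) k P? anti t (outside ∷ U) w<k =
  anti (out⊆ ⊆-refl) (holdsBelow-sound ws k _ (anti ∘ in⊆in) t U w<k)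
holdsBelow-sound (suc w ∷ ws) k P? anti t (outside ∷ U) w<k =
  holdsBelow-sound ws k _ (anti ∘ s⊆s) (proj₁ (Equivalence.to T-∧ t)) U w<k
holdsBelow-sound (suc w ∷ ws) k P? anti t (inside ∷ U) w<k
  with suc w ℕ.<ᵇ k in eq | proj₂ (Equivalence.to (T-∧ {holdsBelow ws k (P? ∘ (outside ∷_))}) t)
... | true  | t′ = holdsBelow-sound ws (k ℕ.∸ suc w) _ (anti ∘ in⊆in) t′ U
  (ℕ.+-cancelˡ-< (suc w) _ _ (subst (suc w ℕ.+ weight (lookup ws) (lookup U) ℕ.<_)
    (sym (ℕ.m+[n∸m]≡n (ℕ.<⇒≤ (ℕ.<ᵇ⇒< (suc w) k (Equivalence.from T-≡ eq))))) w<k))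
-- The skipped branch is empty: this element alone already weighs at least `k`.
... | false | _ = ⊥-elim (subst T eq (ℕ.<⇒<ᵇ (ℕ.≤-<-trans (ℕ.m≤m+n (suc w) _) w<k)))

-- The fractional point is x / q. Refuted is the situation that every edge has x-weight at least q and every
-- transversal has c-weight at least k, although c · x < q k.
record Certificate : Set where
  constructor certificate
  field
    x c : Vec ℕ 13
    q k : ℕ

-- Within Vs U refutes that U contains an edge if no V does; Misses Vs U refutes that U is a transversal if every V
-- contains an edge.
Within Misses : List (Subset 13) → Subset 13 → Set
Within Vs U = Any (U ⊆_) Vs
Misses Vs U = Any (_⊆ ∁ U) Vs

within? : ∀ Vs → Decidable (Within Vs)
within? Vs U = any? (U ⊆?_) Vs

misses? : ∀ Vs → Decidable (Misses Vs)
misses? Vs U = any? (_⊆? ∁ U) Vs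

within-antitone : ∀ Vs → Antitone (Within Vs)
within-antitone Vs {U} {V} U⊆V = Any.map {P = V ⊆_} {Q = U ⊆_} λ V⊆ → ⊆-trans U⊆V V⊆

misses-antitone : ∀ Vs → Antitone (Misses Vs)
misses-antitone Vs {U} {V} U⊆V = Any.map {P = _⊆ ∁ V} {Q = _⊆ ∁ U} λ ⊆∁V → ⊆-trans ⊆∁V (p⊆q⇒∁p⊇∁q U⊆V)

zeroWeight? : (x c : Vec ℕ 13) → Dec (∃[ v ] (lookup c v ≡ 0 ⊎ lookup x v ≡ 0))
zeroWeight? x c = Fin.any? λ v → (lookup c v ℕ.≟ 0) ⊎-dec (lookup x v ℕ.≟ 0)

-- `P` stands for a property that no edge has. The zero coordinate supplies the vertex to delete or
-- contract, so that ideality is applied to a proper minor.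
refutes : {P : Subset 13 → Set} → List (Subset 13) → Decidable P → Certificate → Bool
refutes edges P? (certificate x c q k) =
  isYes (zeroWeight? x c) ∧ holdsBelow x q P? ∧ holdsBelow c k (misses? edges)
  ∧ (total (lookup c) (lookup x) ℕ.<ᵇ q ℕ.* k)

-- The point v of the first step is the first point off L; its cost 11 keeps it out of the transversals considered.
avoiding : ∀ {n} → Subset n → Vec ℕ n × Vec ℕ n
avoiding []            = [] , []
avoiding (inside ∷ L)  = let (x , c) = avoiding L in 1 ∷ x , 2 ∷ c
avoiding (outside ∷ L) = 0 ∷ replicate _ 1 , 11 ∷ Vec.map (λ b → if b then 2 else 3) L

missedLine : Subset 13 → Certificate
missedLine L = let (x , c) = avoiding L in certificate x c 3 11

-- A set of weight below 3 has at most two points besides `v`, so at most three in all, whereas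
-- edges have at least four.
small? : Decidable (λ (U : Subset 13) → ∣ U ∣ ℕ.≤ 3)
small? U = ∣ U ∣ ℕ.≤? 3

-- One evaluation per line; listing `∁ L` among the sets that contain an edge encodes the assumption
-- that some edge misses `L`.
missedLines-refuted : All (λ L → T (refutes (∁ L ∷ lines) small? (missedLine L))) lines
missedLines-refuted = toWitness {a? = All.all? (λ L → T? (refutes (∁ L ∷ lines) small? (missedLine L))) lines} _

-- Case trees over the quadrilaterals.

data Tree : Set where
  split : Subset 13 → Tree → Tree → Tree
  leaf  : Certificate → Tree

-- The lists record the answers so far: sets known to contain an edge, and sets known to contain
-- none.
check : (edges nonedges : List (Subset 13)) → Tree → Bool
check edges nonedges (split U t f) = check (U ∷ edges) nonedges t ∧ check edges (U ∷ nonedges) f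
check edges nonedges (leaf cert)   = refutes edges (within? nonedges) cert

-- Fails every check, because 0 < 0 does.
dead : Tree
dead = leaf (certificate (replicate 13 0) (replicate 13 0) 0 0)

data Side : Set where
  edge cover : Side

opposite : Side → Side
opposite edge  = cover
opposite cover = edge

-- `Q` is a transversal exactly when its complement contains no edge; hence the exchanged branches.
ifSelected : Side → Subset 13 → Tree → Tree → Tree
ifSelected edge  Q t f = split Q t f
ifSelected cover Q t f = split (∁ Q) f t

-- The minor J_q on heavy ∪ light has the edges {heavy, lightᵢ} and light. Its fractional vertex is
-- (q − 1, 1, …, 1) / q, and since J_q is its own blocker the numerators also serve as cost: (q − 1)² + q < q².
-- Points of C are contracted and the remaining ones deleted, or for the side edge the other way round. In J₂, a
-- triangle, all points are light.
weights : (big heavy light : Subset 13) → ℕ → Vec ℕ 13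
weights big heavy light q = tabulate λ i →
  if lookup big i then q else if lookup heavy i then q ℕ.∸ 1 else if lookup light i then 1 else 0

-- For `cover`, weight `q` in `x` keeps deleted points out of the light sets, and in `c` it keeps
-- contracted points out of the cheap ones. For `edge` the two vectors are exchanged.
degenerate : Side → (C heavy light : Subset 13) → ℕ → Tree
degenerate s C heavy light q =
  leaf (arrange s (weights (∁ (C ∪ heavy ∪ light)) heavy light q) (weights C heavy light q))
  where
  arrange : Side → Vec ℕ 13 → Vec ℕ 13 → Certificate
  arrange cover x c = certificate x c q q
  arrange edge  x c = certificate c x q q

elements : Subset 13 → List (Fin 13)
elements U = filterᵇ (lookup U) (allFin 13)

isTransversal : Subset 13 → Bool
isTransversal U = not (does (misses? lines U))

-- Removing a diagonal point of Q from the complement of Q leaves a quadrilateral.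
neighbours : Subset 13 → List (Subset 13)
neighbours Q = filterᵇ isTransversal (map (λ p → ∁ Q ─ ⁅ p ⁆) (elements (∁ Q)))

otherNeighbours : Subset 13 → Subset 13 → List (Subset 13)
otherNeighbours R Q = filterᵇ (λ S → not (does (≡-dec Bool._≟_ R S))) (neighbours Q)

-- If R₁ and R₂ are selected, there is a minor J₂ when R₃ is selected too, J₃ when R₃ and a further neighbour S
-- of R₃ are free, and J₄ when R₃ is free and both of its further neighbours are selected.
twoSelected : Side → (Q R₁ R₂ R₃ : Subset 13) → Tree
twoSelected s Q R₁ R₂ R₃ = ifSelected s R₃
  (degenerate s Q ∅ (apex R₁ ∪ apex R₂ ∪ apex R₃) 2)
  (outer (otherNeighbours Q R₃))
  where
  -- A neighbour `R` is `∁ Q` minus one point, and this is that point. For `cover`, `R` is selected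
  -- when `Q` together with the point contains no edge.
  apex : Subset 13 → Subset 13
  apex R = ∁ R ─ Q

  outer : List (Subset 13) → Tree
  outer (S ∷ S′ ∷ []) = ifSelected (opposite s) S
    (ifSelected (opposite s) S′
      (degenerate s (Q ∩ S ∩ S′) (apex R₃) ((S ─ S′) ∪ (S′ ─ S) ∪ apex R₁ ∪ apex R₂) 4)
      (free S′))
    (free S)
    where
    free : Subset 13 → Tree
    free S = degenerate s (Q ∩ S) (S ─ Q) ((Q ─ S) ∪ apex R₁ ∪ apex R₂) 3
  outer _ = dead

-- `Q₀` and `Q₂` are both `∁ Q₁` minus a point, so each difference is a single point. For `cover`,
-- delete `Q₀ ∩ Q₂` and contract all but three points: that `Q₀` and `Q₂` are free gives two pairs
-- as edges of `J₂`, and that `Q₁` and `Q₃` are free excludes two singletons.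
freePath : Side → (Q₀ Q₁ Q₂ Q₃ : Subset 13) → Tree
freePath s Q₀ Q₁ Q₂ Q₃ = degenerate (opposite s) (Q₀ ∩ Q₂) ∅ ((Q₀ ─ Q₂) ∪ (Q₂ ─ Q₀) ∪ (∁ Q₃ ─ Q₂)) 2

withTwoFree : Side → Subset 13 → (Subset 13 → Subset 13 → Tree) → Tree
withTwoFree s Q then = cases (neighbours Q)
  where
  cases : List (Subset 13) → Tree
  cases (R₁ ∷ R₂ ∷ R₃ ∷ []) = ifSelected s R₁
    (ifSelected s R₂ (twoSelected s Q R₁ R₂ R₃) (ifSelected s R₃ (twoSelected s Q R₁ R₃ R₂) (then R₂ R₃)))
    (ifSelected s R₂ (ifSelected s R₃ (twoSelected s Q R₂ R₃ R₁) (then R₁ R₃)) (then R₁ R₂))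
  cases _ = dead

-- `R` is the neighbour already on the path; it serves as the third one if both others are selected.
withOtherFree : Side → (R Q : Subset 13) → (Subset 13 → Tree) → Tree
withOtherFree s R Q then = cases (otherNeighbours R Q)
  where
  cases : List (Subset 13) → Tree
  cases (R₁ ∷ R₂ ∷ []) = ifSelected s R₁ (ifSelected s R₂ (twoSelected s Q R₁ R₂ R) (then R₂)) (then R₁)
  cases _ = dead

-- The free path is `R′`, `S`, `R`, `S′`, grown outwards from `R`. The start `Q`, on the side
-- `edge`, only has to supply `R` and may itself be selected.
refutation : Subset 13 → Tree
refutation Q = withTwoFree cover Q λ R _ → withTwoFree edge R λ S S′ →
  withOtherFree cover R S λ R′ → freePath cover R′ S R S′

-- The points where two of the lines x = 0, y = 0, z = 0 and x + 2y + 2z = 0 meet.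
quadrilateral : Subset 13
quadrilateral =
  inside ∷ inside ∷ outside ∷ inside ∷ outside ∷ outside ∷ outside ∷ outside ∷ outside ∷
  inside ∷ outside ∷ inside ∷
  inside ∷ []

-- The initial knowledge is that lines contain edges and their complements do not; the rest is
-- evaluation.
refutation-checks : T (check lines (map ∁ lines) (refutation quadrilateral))
refutation-checks = _

-- Soundness of certificates and trees for the clutter.

module _ {m} (E : Family (suc m)) (proper : ∀ {k} (F : Family k) → ProperMinor E F → Ideal F)
         (f : Fin (suc m) ↔ PGPoint) where

  σ : Fin (suc m) ↔ Fin 13
  σ = mk↔ₛ′ index (lookup points) index-lookup lookup-index ↔-∘ f

  image : (Fin (suc m) → Bool) → Subset 13
  image b = tabulate λ i → b (σ ⟨$⟩ˡ i)

  lookup-image⁻¹ : ∀ b i → lookup (image b) i ≡ b (σ ⟨$⟩ˡ i)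
  lookup-image⁻¹ b = lookup∘tabulate λ i → b (σ ⟨$⟩ˡ i)

  lookup-image : ∀ b v → lookup (image b) (σ ⟨$⟩ʳ v) ≡ b v
  lookup-image b v = trans (lookup-image⁻¹ b (σ ⟨$⟩ʳ v)) (cong b (inverseˡ σ))

  ∈-image : ∀ b v → b v ≡ true → (σ ⟨$⟩ʳ v) Data.Fin.Subset.∈ image b
  ∈-image b v e = lookup⇒[]= (σ ⟨$⟩ʳ v) (image b) (trans (lookup-image b v) e)

  weight-image : ∀ w b → weight (λ v → w (σ ⟨$⟩ʳ v)) b ≡ weight w (lookup (image b))
  weight-image w b = sym (trans (sum-permute (λ i → if lookup (image b) i then w i else 0) σ)
    (sum-cong-≗ λ v → cong (if_then w (σ ⟨$⟩ʳ v) else 0) (lookup-image b v)))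

  HasEdge : Subset 13 → Set
  HasEdge U = ∃[ H ] H ∈ E × image (lookup H) ⊆ U

  -- Sets of `x`-weight below `q` satisfy `P`, so edges are heavy and `cheapTransversal` yields a
  -- transversal of cost below `k`. By the enumeration it misses some `V` in `edges`, although `V`
  -- contains an edge.
  refutes-sound : {P : Subset 13 → Set} (edges : List (Subset 13)) (P? : Decidable P) (cert : Certificate) →
    Antitone P → T (refutes edges P? cert) → All HasEdge edges → ¬ (∀ {H} → H ∈ E → ¬ P (image (lookup H)))
  refutes-sound {P} edges P? (certificate x c q k) anti ok edges✓ noP
    with zero-ok , ok₁ ← Equivalence.to (T-∧ {isYes (zeroWeight? x c)}) ok
    with x-ok , ok₂ ← Equivalence.to (T-∧ {holdsBelow x q P?}) ok₁
    with c-ok , cheap ← Equivalence.to (T-∧ {holdsBelow c k (misses? edges)}) ok₂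
    with v₀ , vanishes ← toWitness {a? = zeroWeight? x c} zero-ok =
    cheapTransversal E (σ ⟨$⟩ˡ v₀) proper (λ v → lookup x (σ ⟨$⟩ʳ v)) (λ v → lookup c (σ ⟨$⟩ʳ v)) q k
      (subst (λ i → lookup c i ≡ 0 ⊎ lookup x i ≡ 0) (sym (inverseʳ σ)) vanishes) heavy
      (subst (ℕ._< q ℕ.* k) (sum-permute (λ i → lookup c i ℕ.* lookup x i) σ) (ℕ.<ᵇ⇒< _ _ cheap))
      contradiction
    where
    heavy : ∀ {H} → H ∈ E → q ℕ.≤ weight (λ v → lookup x (σ ⟨$⟩ʳ v)) (lookup H)
    heavy {H} H∈E = ℕ.≮⇒≥ λ light → noP H∈E
      (holdsBelow-sound x q P? anti x-ok (image (lookup H)) (subst (ℕ._< q) (weight-image (lookup x) (lookup H)) light))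

    contradiction : ¬ (∃[ b ] Transversal E b × weight (λ v → lookup c (σ ⟨$⟩ʳ v)) b ℕ.< k)
    contradiction (b , meets , light) = let
      (V , V∈ , V⊆∁b) = find (holdsBelow-sound c k (misses? edges) (misses-antitone edges) c-ok (image b)
        (subst (ℕ._< k) (weight-image (lookup c) b) light))
      (H , H∈E , H⊆V) = All.lookup edges✓ V∈
      (v , v∈H , v∈b) = meets H∈E
      in x∈p⇒x∉∁p (∈-image b v v∈b) (V⊆∁b (H⊆V (∈-image (lookup H) v v∈H)))

  check-sound : ∀ tree {edges nonedges} → T (check edges nonedges tree) →
    All HasEdge edges → All (¬_ ∘ HasEdge) nonedges → ⊥
  check-sound (split U t f) {edges} {nonedges} ok has hasn′t
    with t-ok , f-ok ← Equivalence.to (T-∧ {check (U ∷ edges) nonedges t}) ok =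
    -- The refutation of the first branch is itself the proof that `U` contains no edge, which the
    -- second branch assumes.
    check-sound f f-ok has ((λ yes → check-sound t t-ok (yes ∷ has) hasn′t) ∷ hasn′t)
  check-sound (leaf cert) {edges} {nonedges} ok has hasn′t =
    refutes-sound edges (within? nonedges) cert (within-antitone nonedges) ok has λ {H} H∈E within →
      let (V , V∈ , H⊆V) = find within in All.lookup hasn′t V∈ (H , H∈E , H⊆V)

  -- The lines of the core, and the conclusion.

  module _ (core : ∀ ℓ → ∃[ H ] (MinWeight E H × IsLineSet f ℓ H)) where

    to-σ⁻¹ : ∀ i → Inverse.to f (σ ⟨$⟩ˡ i) ≡ lookup points i
    to-σ⁻¹ i = Inverse.strictlyInverseˡ f (lookup points i)

    lookup-lineSet : ∀ ℓ i → lookup (lineSet ℓ) i ≡ isYes (onLine? (lookup points i) ℓ)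
    lookup-lineSet ℓ i = lookup-map i (λ p → isYes (onLine? p ℓ)) points

    image⊆lineSet : ∀ ℓ H → IsLineSet f ℓ H → image (lookup H) ⊆ lineSet ℓ
    image⊆lineSet ℓ H isLine {i} i∈ = lookup⇒[]= i (lineSet ℓ) (trans (lookup-lineSet ℓ i)
      (Equivalence.to T-≡ (fromWitness {a? = onLine? (lookup points i) ℓ} (subst (λ p → OnLine p ℓ) (to-σ⁻¹ i)
        (proj₁ (isLine _) (trans (sym (lookup-image⁻¹ (lookup H) i)) ([]=⇒lookup i∈)))))))

    lineSet⊆image : ∀ ℓ H → IsLineSet f ℓ H → lineSet ℓ ⊆ image (lookup H)
    lineSet⊆image ℓ H isLine {i} i∈ = lookup⇒[]= i (image (lookup H)) (trans (lookup-image⁻¹ (lookup H) i)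
      (proj₂ (isLine _) (subst (λ p → OnLine p ℓ) (sym (to-σ⁻¹ i))
        (toWitness {a? = onLine? (lookup points i) ℓ}
          (Equivalence.from T-≡ (trans (sym (lookup-lineSet ℓ i)) ([]=⇒lookup i∈)))))))

    size-weight : ∀ {n} (U : Subset n) → ∣ U ∣ ≡ weight (λ _ → 1) (lookup U)
    size-weight []            = refl
    size-weight (inside ∷ U)  = cong suc (size-weight U)
    size-weight (outside ∷ U) = size-weight U

    size-image : ∀ H → ∣ image (lookup H) ∣ ≡ ∣ H ∣
    size-image H = trans (size-weight (image (lookup H)))
      (trans (sym (weight-image (λ _ → 1) (lookup H))) (sym (size-weight H)))

    line-hasEdge : ∀ ℓ → HasEdge (lineSet ℓ)
    line-hasEdge ℓ with H , (H∈E , _) , isLine ← core ℓ = H , H∈E , image⊆lineSet ℓ H isLine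

    lines-haveEdge : All HasEdge lines
    lines-haveEdge = All.map⁺ (All.universal line-hasEdge (toList points))

    -- The edge on any one line has minimum size, and the size of its `lineSet` evaluates to four.
    not-small : ∀ {H} → H ∈ E → ¬ ∣ image (lookup H) ∣ ℕ.≤ 3
    not-small {H} H∈E small = let
      ℓ = lookup points 0F
      (H₀ , (_ , minimum) , isLine) = core ℓ
      in ℕ.<⇒≱ (ℕ.≤-trans (p⊆q⇒∣p∣≤∣q∣ (lineSet⊆image ℓ H₀ isLine))
           (ℕ.≤-trans (ℕ.≤-reflexive (size-image H₀)) (ℕ.≤-trans (minimum H∈E)
             (ℕ.≤-reflexive (sym (size-image H)))))) small

    colines-haveNoEdge : All (¬_ ∘ HasEdge) (map ∁ lines)
    colines-haveNoEdge = All.map⁺ (All.map (λ {L} ok hasEdge →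
      refutes-sound (∁ L ∷ lines) small? (missedLine L)
        (λ U⊆V V≤3 → ℕ.≤-trans (p⊆q⇒∣p∣≤∣q∣ U⊆V) V≤3) ok (hasEdge ∷ lines-haveEdge) not-small)
      missedLines-refuted)

    properMinorsNotAllIdeal : ⊥
    properMinorsNotAllIdeal = check-sound (refutation quadrilateral) refutation-checks lines-haveEdge colines-haveNoEdge

theorem6p5 : ∀ (n : ℕ) (E : Family n) → IsClutter E → (f : Fin n ↔ PGPoint) →
    CoreIsPG23 E f → ¬ MinimallyNonideal E
-- An empty vertex set has no bijection with the points.
theorem6p5 zero E _ f _ _ with () ← Inverse.from f (lookup points 0F)
theorem6p5 (suc m) E _ f (_ , core) (_ , proper) = properMinorsNotAllIdeal E proper f core
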